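{- Let $n \ge 1$ be an integer and let $K_{3,n}$ be the complete bipartite graph with parts of sizes $3$ and $n$. Then the regular number of $K_{3,n}$ is given by $r(K_{3,n}) = n/3$ if $n \equiv 0 \pmod 3$, and $r(K_{3,n}) = \left\lfloor \frac{n}{3} \right\rfloor + 3$ if $n \equiv 1$ or $2 \pmod 3$.
   Context: All graphs are finite, simple and undirected. For a set $F$ of edges of a graph $G$, the subgraph induced by $F$, denoted $\langle F \rangle$, is the graph whose edge set is $F$ and whose vertex set is the set of endpoints of edges in $F$ (it need not contain all the vertices of $G$). The regular number $r(G)$ of a graph $G=(V,E)$ is the minimum number of nonempty subsets into which the edge set $E$ can be partitioned so that the subgraph induced by each subset is regular (i.e. all of its vertices have the same degree; different subsets may have different degrees of regularity, and the induced subgraphs need not be connected). -}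

module Defs where

open import Data.Bool.Base using (Bool; true; false; _xor_)
open import Data.Bool.Properties using (xor-comm; xor-same)
open import Data.Fin.Base using (Fin; splitAt)
open import Data.Fin.Subset using (Subset; _∈_; _∉_; ⊤; ∣_∣)
open import Data.Fin.Subset.Properties using (nonempty?; ∈⊤)
open import Data.Nat.Base using (ℕ; _+_; _≤_)
open import Data.Product.Base using (_×_; _,_; ∃; ∃-syntax; ∃₂)
open import Data.Sum.Base using ([_,_]′)
open import Data.Vec.Base using (tabulate)
open import Data.Vec.Properties using (lookup∘tabulate; []=⇒lookup; lookup⇒[]=)
open import Function.Base using (const)
open import Relation.Binary.PropositionalEquality using (_≡_; sym; trans)
open import Relation.Nullary.Negation.Core using (contradiction)
open import Relation.Nullary.Decidable using (does; dec-true)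

∈-tabulate⁺ : ∀ {N} (f : Fin N → Bool) {v} → f v ≡ true → v ∈ tabulate f
∈-tabulate⁺ f {v} eq = lookup⇒[]= v (tabulate f) (trans (lookup∘tabulate f v) eq)

∈-tabulate⁻ : ∀ {N} (f : Fin N → Bool) {v} → v ∈ tabulate f → f v ≡ true
∈-tabulate⁻ f {v} v∈ = trans (sym (lookup∘tabulate f v)) ([]=⇒lookup v∈)

-- A set of unordered pairs {u , v} of distinct elements of Fin N, given by
-- the neighbourhood of each element: {u , v} belongs to it iff v ∈ nbr u.
record EdgeSet (N : ℕ) : Set where
  field
    nbr    : Fin N → Subset N
    symm   : ∀ {u v} → v ∈ nbr u → u ∈ nbr v
    irrefl : ∀ {v} → v ∉ nbr v

infix 4 _—_∈ₑ_

_—_∈ₑ_ : ∀ {N} → Fin N → Fin N → EdgeSet N → Set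
u — v ∈ₑ F = v ∈ EdgeSet.nbr F u

-- A finite simple graph whose vertex set is a subset of Fin N, possibly
-- proper: edge-induced subgraphs live in the same ambient Fin N.
record Graph (N : ℕ) : Set where
  field
    vertices : Subset N
    edges    : EdgeSet N
    incident : ∀ {u v} → u — v ∈ₑ edges → u ∈ vertices

  degree : Fin N → ℕ
  degree v = ∣ EdgeSet.nbr edges v ∣

open Graph public using (vertices; edges; degree)

Regular : ∀ {N} → Graph N → Set
Regular G = ∃[ d ] (∀ v → v ∈ vertices G → degree G v ≡ d)

⟨_⟩ : ∀ {N} → EdgeSet N → Graph N
⟨ F ⟩ = record
  { vertices = tabulate isEndpoint
  ; edges    = F
  ; incident = λ {u} {v} uv → ∈-tabulate⁺ isEndpoint (dec-true (nonempty? (nbr u)) (v , uv))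
  }
  where
  open EdgeSet F
  isEndpoint : Fin _ → Bool
  isEndpoint u = does (nonempty? (nbr u))

record RegularPartition {N : ℕ} (G : Graph N) (k : ℕ) : Set where
  field
    part     : Fin k → EdgeSet N
    nonempty : ∀ i → ∃₂ λ u v → u — v ∈ₑ part i
    included : ∀ i {u v} → u — v ∈ₑ part i → u — v ∈ₑ edges G
    covering : ∀ {u v} → u — v ∈ₑ edges G → ∃[ i ] u — v ∈ₑ part i
    disjoint : ∀ {i j u v} → u — v ∈ₑ part i → u — v ∈ₑ part j → i ≡ j
    regular  : ∀ i → Regular ⟨ part i ⟩

IsRegularNumber : ∀ {N} → Graph N → ℕ → Set
IsRegularNumber G r = RegularPartition G r × (∀ k → RegularPartition G k → r ≤ k)

-- The first m elements of Fin (m + n) form one part, the last n the other.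
completeBipartite : ∀ m n → Graph (m + n)
completeBipartite m n = record
  { vertices = ⊤
  ; edges    = record
    { nbr    = λ u → tabulate (adjacent u)
    ; symm   = λ {u} {v} v∈ → ∈-tabulate⁺ (adjacent v)
                 (trans (xor-comm (isLeft v) (isLeft u)) (∈-tabulate⁻ (adjacent u) v∈))
    ; irrefl = λ {v} v∈ → contradiction
                 (trans (sym (∈-tabulate⁻ (adjacent v) v∈)) (xor-same (isLeft v))) λ ()
    }
  ; incident = λ _ → ∈⊤
  }
  where
  isLeft : Fin (m + n) → Bool
  isLeft u = [ const true , const false ]′ (splitAt m u)

  adjacent : Fin (m + n) → Fin (m + n) → Bool
  adjacent u v = isLeft u xor isLeft v

{-# OPTIONS --safe #-}
module Submission where

-- Lower bound.  A regular subgraph of K_{3,n} has degree 1, 2 or 3; one of degree 3 is a K_{3,3} and uses up its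
-- three columns (vertices of the n-side).  Suppose N₁, N₂, N₃ parts have degree 1, 2, 3, so that m = n - 3 N₃
-- columns remain, and suppose 3 ∤ n.  A row meeting p parts of degree 1 and q of degree 2 has p + 2 q = m, hence
-- m ≤ N₁ + 2 N₂.  A remaining column meets either three parts of degree 1, and then N₁ ≥ 3, or one of degree 1
-- and one of degree 2; if all are of the latter kind, then m ≤ 3 N₁ and m ≤ 3 N₂, and N₁ = N₂ = 1 is excluded
-- because p and q would be the same in all rows.  In every case m + 6 ≤ 3 (N₁ + N₂), strictly since 3 ∤ m, so
-- n + 6 < 3 (N₁ + N₂ + N₃).
-- Upper bound.  Split off copies of K_{3,3}, and cover the remaining K_{3,1} or K_{3,2} with three matchings.

open import Data.Nat using (ℕ; _+_; _≤_; _/_; _%_)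
open import Data.Product using (_×_)
open import Data.Sum using (_⊎_)
open import Relation.Binary.PropositionalEquality using (_≡_)
open import Defs

open import Data.Bool.Base using (Bool; true; false; if_then_else_; _xor_)
open import Data.Empty using (⊥; ⊥-elim)
open import Data.Fin.Base using (Fin; zero; suc; splitAt; join; toℕ; _↑ˡ_; _↑ʳ_)
open import Data.Fin.Patterns using (0F; 1F; 2F)
open import Data.Fin.Properties as Finₚ using (all?; splitAt-join; join-splitAt)
open import Data.Fin.Subset using (Subset; _∈_; Nonempty; ∣_∣)
open import Data.Fin.Subset.Properties
  using (nonempty?; Empty-unique; ∣⊥∣≡0; x∈p⇒∣p-x∣<∣p∣)
open import Data.Nat using (zero; suc; _*_; _<_; _≤?_; z≤n; s≤s; s≤s⁻¹)
open import Data.Nat.DivMod using (_mod_; m≡m%n+[m/n]*n; [m+kn]%n≡m%n; m*n%n≡0)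
open import Data.Nat.Properties
open import Data.Nat.Tactic.RingSolver using (solve-∀)
open import Data.Product using (_,_; proj₁; proj₂; ∃; ∃₂)
open import Data.Sum using (inj₁; inj₂; [_,_]′)
open import Data.Unit.Base using (tt)
open import Data.Vec.Base using ([]; _∷_; lookup; tabulate)
open import Data.Vec.Properties using (lookup∘tabulate; []=⇒lookup; lookup⇒[]=)
open import Function.Base using (_∘_; const)
open import Relation.Binary.PropositionalEquality
  using (_≢_; refl; sym; trans; cong; cong₂; subst; module ≡-Reasoning)
open import Relation.Nullary using (Dec; yes; no; does; ¬_; contradiction)
open import Relation.Nullary.Decidable using (dec-true; toWitness; True; _⊎-dec_)

open import Algebra.Properties.Semiring.Sum +-*-semiring
  using (sum; sum-syntax; sum-cong-≗; ∑-comm; ∑-distrib-+; *-distribˡ-sum)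

-- Finite sums, indicators and double counting

⟦_⟧ : Bool → ℕ
⟦ b ⟧ = if b then 1 else 0

⟦⟧≤1 : ∀ b → ⟦ b ⟧ ≤ 1
⟦⟧≤1 true  = ≤-refl
⟦⟧≤1 false = z≤n

sum-zero : ∀ {n} (f : Fin n → ℕ) → (∀ i → f i ≡ 0) → sum f ≡ 0
sum-zero {zero}  f f≡0 = refl
sum-zero {suc n} f f≡0 = cong₂ _+_ (f≡0 zero) (sum-zero (f ∘ suc) (f≡0 ∘ suc))

sum-mono : ∀ {n} {f g : Fin n → ℕ} → (∀ i → f i ≤ g i) → sum f ≤ sum g
sum-mono {zero}  f≤g = z≤n
sum-mono {suc n} f≤g = +-mono-≤ (f≤g zero) (sum-mono (f≤g ∘ suc))

sum-one : ∀ {n} (f : Fin n → ℕ) → (∀ i → f i ≡ 1) → sum f ≡ n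
sum-one {zero}  f f≡1 = refl
sum-one {suc n} f f≡1 = cong₂ _+_ (f≡1 zero) (sum-one (f ∘ suc) (f≡1 ∘ suc))

term≤sum : ∀ {n} (f : Fin n → ℕ) i → f i ≤ sum f
term≤sum f zero    = m≤m+n _ _
term≤sum f (suc i) = ≤-trans (term≤sum (f ∘ suc) i) (m≤n+m _ _)

sum-≤1 : ∀ {n} (f : Fin n → ℕ) → (∀ i → f i ≤ 1) → sum f ≤ n
sum-≤1 {n} f f≤1 = ≤-trans (sum-mono f≤1) (≤-reflexive (sum-one {n} (const 1) λ _ → refl))

-- A single `false` would leave too few terms to reach the maximal total. This later shows that a
-- part of degree 3 fills every column it meets.
sum-⟦⟧-full : ∀ {n} (b : Fin n → Bool) → ∑[ i < n ] ⟦ b i ⟧ ≡ n → ∀ i → b i ≡ true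
sum-⟦⟧-full {suc n} b eq i with b zero in b₀
... | false = contradiction (≤-reflexive (sym eq)) (≤⇒≯ (sum-≤1 {n} _ (⟦⟧≤1 ∘ b ∘ suc)))
sum-⟦⟧-full {suc n} b eq zero    | true = b₀
sum-⟦⟧-full {suc n} b eq (suc i) | true = sum-⟦⟧-full (b ∘ suc) (suc-injective eq) i

sum-+ : ∀ m {n} (f : Fin (m + n) → ℕ) →
        sum f ≡ ∑[ x < m ] f (x ↑ˡ n) + ∑[ y < n ] f (m ↑ʳ y)
sum-+ zero    f = refl
sum-+ (suc m) f = trans (cong (f zero +_) (sum-+ m (f ∘ suc))) (sym (+-assoc (f zero) _ _))

size≡sum : ∀ {n} (p : Subset n) → ∣ p ∣ ≡ ∑[ v < n ] ⟦ lookup p v ⟧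
size≡sum []          = refl
size≡sum (true ∷ p)  = cong suc (size≡sum p)
size≡sum (false ∷ p) = size≡sum p

δ : ∀ {k} → Fin k → Fin k → ℕ
δ i j = ⟦ does (i Finₚ.≟ j) ⟧

δ-refl : ∀ {k} (i : Fin k) → δ i i ≡ 1
δ-refl i = cong ⟦_⟧ (dec-true (i Finₚ.≟ i) refl)

sum-δ : ∀ {k} (w : Fin k → ℕ) j → ∑[ i < k ] (w i * δ j i) ≡ w j
sum-δ {suc k} w zero = begin
  w zero * 1 + ∑[ i < k ] (w (suc i) * 0)  ≡⟨ cong₂ _+_ (*-identityʳ _) (sum-zero {k} _ λ i → *-zeroʳ (w (suc i))) ⟩
  w zero + 0                               ≡⟨ +-identityʳ _ ⟩
  w zero                                   ∎
  where open ≡-Reasoning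
sum-δ {suc k} w (suc j) = cong₂ _+_ (*-zeroʳ (w zero)) (sum-δ (w ∘ suc) j)

-- When `f` lists the colours along a row or column, this is the degree of that vertex in part `i`.
tally : ∀ {n k} → (Fin n → Fin k) → Fin k → ℕ
tally {n} f i = ∑[ y < n ] δ (f y) i

tally≤ : ∀ {n k} (f : Fin n → Fin k) i → tally f i ≤ n
tally≤ f i = sum-≤1 _ λ y → ⟦⟧≤1 _

tally-pos : ∀ {n k} (f : Fin n → Fin k) y → 1 ≤ tally f (f y)
tally-pos f y = ≤-trans (≤-reflexive (sym (δ-refl (f y)))) (term≤sum (λ z → δ (f z) (f y)) y)

-- Double counting: the cells of a line are grouped by their colour.
sum-tally : ∀ {n k} (w : Fin k → ℕ) (f : Fin n → Fin k) →
            ∑[ y < n ] w (f y) ≡ ∑[ i < k ] (w i * tally f i)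
sum-tally {n} {k} w f = begin
  ∑[ y < n ] w (f y)                          ≡⟨ sum-cong-≗ (λ y → sym (sum-δ w (f y))) ⟩
  ∑[ y < n ] ∑[ i < k ] (w i * δ (f y) i)     ≡⟨ ∑-comm (λ y i → w i * δ (f y) i) ⟩
  ∑[ i < k ] ∑[ y < n ] (w i * δ (f y) i)     ≡⟨ sum-cong-≗ (λ i → sym (*-distribˡ-sum (w i) (λ y → δ (f y) i))) ⟩
  ∑[ i < k ] (w i * tally f i)                ∎
  where open ≡-Reasoning

-- Degree 0 accounts for vertices outside an edge-induced subgraph, so regularity becomes a
-- condition on all vertices.
ZeroOr : ℕ → ℕ → Set
ZeroOr d x = x ≡ 0 ⊎ x ≡ d

zeroOr? : ∀ d x → Dec (ZeroOr d x)
zeroOr? d x = (x ≟ 0) ⊎-dec (x ≟ d)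

-- A regular partition of K_{m,n} seen as an m × n array of part indices: colour x y is the
-- part containing the edge from x to y, and deg i is the degree of regularity of part i.
record RegularColouring (m n k : ℕ) : Set where
  field
    colour : Fin m → Fin n → Fin k
    deg    : Fin k → ℕ
    row    : ∀ i x → ZeroOr (deg i) (tally (colour x) i)
    column : ∀ i y → ZeroOr (deg i) (tally (λ x → colour x y) i)
    onto   : ∀ i → ∃₂ λ x y → colour x y ≡ i

-- Regular partitions and regular colourings

does-true⁻ : ∀ {A : Set} (a? : Dec A) → does a? ≡ true → A
does-true⁻ (yes a) _ = a

-- Adjacency in `completeBipartite` with `splitAt` stripped off, so that pattern matching on the two
-- sides decides it.
xor-side : ∀ {m n} → Fin m ⊎ Fin n → Fin m ⊎ Fin n → Bool
xor-side s t = [ const true , const false ]′ s xor [ const true , const false ]′ t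

classAdj : ∀ {m n k} → (Fin m → Fin n → Fin k) → Fin k → Fin m ⊎ Fin n → Fin m ⊎ Fin n → Bool
classAdj c i (inj₁ x) (inj₂ y) = does (c x y Finₚ.≟ i)
classAdj c i (inj₂ y) (inj₁ x) = does (c x y Finₚ.≟ i)
classAdj c i (inj₁ _) (inj₁ _) = false
classAdj c i (inj₂ _) (inj₂ _) = false

module _ {m n k} (c : Fin m → Fin n → Fin k) where

  classAdj-sym : ∀ i s t → classAdj c i s t ≡ true → classAdj c i t s ≡ true
  classAdj-sym i (inj₁ x) (inj₂ y) st = st
  classAdj-sym i (inj₂ y) (inj₁ x) st = st

  classAdj-irrefl : ∀ i s → classAdj c i s s ≢ true
  classAdj-irrefl i (inj₁ _) ()
  classAdj-irrefl i (inj₂ _) ()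

  classAdj⇒xor : ∀ i s t → classAdj c i s t ≡ true → xor-side s t ≡ true
  classAdj⇒xor i (inj₁ x) (inj₂ y) _ = refl
  classAdj⇒xor i (inj₂ y) (inj₁ x) _ = refl

  xor⇒classAdj : ∀ s t → xor-side s t ≡ true → ∃ λ i → classAdj c i s t ≡ true
  xor⇒classAdj (inj₁ x) (inj₂ y) _ = c x y , dec-true (c x y Finₚ.≟ c x y) refl
  xor⇒classAdj (inj₂ y) (inj₁ x) _ = c x y , dec-true (c x y Finₚ.≟ c x y) refl

  classAdj-unique : ∀ i j s t → classAdj c i s t ≡ true → classAdj c j s t ≡ true → i ≡ j
  classAdj-unique i j (inj₁ x) (inj₂ y) p q =
    trans (sym (does-true⁻ (c x y Finₚ.≟ i) p)) (does-true⁻ (c x y Finₚ.≟ j) q)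
  classAdj-unique i j (inj₂ y) (inj₁ x) p q =
    trans (sym (does-true⁻ (c x y Finₚ.≟ i) p)) (does-true⁻ (c x y Finₚ.≟ j) q)

  classDegree : Fin k → Fin m ⊎ Fin n → ℕ
  classDegree i = [ (λ x → tally (c x) i) , (λ y → tally (λ x → c x y) i) ]′

  -- Neighbours lie only on the opposite side, so one of the two halves of the sum over `m + n`
  -- vanishes and the other is a tally.
  size-class : ∀ i s (p : Subset (m + n)) →
               (∀ t → lookup p (join m n t) ≡ classAdj c i s t) → ∣ p ∣ ≡ classDegree i s
  size-class i s p p≗ = trans (size≡sum p) (trans (sum-+ m _) (sides s p≗))
    where
    sides : ∀ s → (∀ t → lookup p (join m n t) ≡ classAdj c i s t) →
            ∑[ x < m ] ⟦ lookup p (x ↑ˡ n) ⟧ + ∑[ y < n ] ⟦ lookup p (m ↑ʳ y) ⟧ ≡ classDegree i s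
    sides (inj₁ x) eq = cong₂ _+_ (sum-zero {m} _ λ x → cong ⟦_⟧ (eq (inj₁ x)))
                                  (sum-cong-≗ {n} λ y → cong ⟦_⟧ (eq (inj₂ y)))
    sides (inj₂ y) eq = trans
      (cong₂ _+_ (sum-cong-≗ {m} λ x → cong ⟦_⟧ (eq (inj₁ x)))
                 (sum-zero {n} _ λ y → cong ⟦_⟧ (eq (inj₂ y))))
      (+-identityʳ _)

∈⇒size≢0 : ∀ {n} {p : Subset n} {v} → v ∈ p → ∣ p ∣ ≢ 0
∈⇒size≢0 v∈p = m<n⇒n≢0 (x∈p⇒∣p-x∣<∣p∣ v∈p)

endpoint⁻ : ∀ {N} (F : EdgeSet N) {v} → v ∈ vertices ⟨ F ⟩ → Nonempty (EdgeSet.nbr F v)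
endpoint⁻ F {v} v∈ = does-true⁻ (nonempty? (EdgeSet.nbr F v)) (∈-tabulate⁻ _ v∈)

endpoint⁺ : ∀ {N} (F : EdgeSet N) {v} → Nonempty (EdgeSet.nbr F v) → v ∈ vertices ⟨ F ⟩
endpoint⁺ F {v} (w , vw) = Graph.incident ⟨ F ⟩ vw

regular⁺ : ∀ {N} (F : EdgeSet N) d → (∀ v → ZeroOr d ∣ EdgeSet.nbr F v ∣) → Regular ⟨ F ⟩
regular⁺ F d 0orD = d , λ v v∈ →
  [ (λ size≡0 → contradiction size≡0 (∈⇒size≢0 (proj₂ (endpoint⁻ F v∈)))) , (λ eq → eq) ]′ (0orD v)

regular⁻ : ∀ {N} (F : EdgeSet N) ((d , _) : Regular ⟨ F ⟩) → ∀ v → ZeroOr d ∣ EdgeSet.nbr F v ∣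
regular⁻ {N} F (d , reg) v with nonempty? (EdgeSet.nbr F v)
... | yes ne = inj₂ (reg v (endpoint⁺ F ne))
... | no ¬ne = inj₁ (trans (cong ∣_∣ (Empty-unique ¬ne)) (∣⊥∣≡0 N))

lookup≡does : ∀ {n} {p : Subset n} {v} {A : Set} (a? : Dec A) →
              (A → v ∈ p) → (v ∈ p → A) → lookup p v ≡ does a?
lookup≡does (yes a) to _ = []=⇒lookup (to a)
lookup≡does {p = p} {v} (no ¬a) _ from with lookup p v in eq
... | true  = contradiction (from (lookup⇒[]= v p eq)) ¬a
... | false = refl

module FromColouring {m n k} (K : RegularColouring m n k) where
  open RegularColouring K

  part : Fin k → EdgeSet (m + n)
  part i = record
    { nbr    = λ u → tabulate (adj u)
    ; symm   = λ {u} {v} uv → ∈-tabulate⁺ (adj v)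
                 (classAdj-sym colour i (splitAt m u) (splitAt m v) (∈-tabulate⁻ (adj u) uv))
    ; irrefl = λ {v} vv → classAdj-irrefl colour i (splitAt m v) (∈-tabulate⁻ (adj v) vv)
    }
    where
    adj : Fin (m + n) → Fin (m + n) → Bool
    adj u v = classAdj colour i (splitAt m u) (splitAt m v)

  edge⁻ : ∀ i {u v} → u — v ∈ₑ part i → classAdj colour i (splitAt m u) (splitAt m v) ≡ true
  edge⁻ i uv = ∈-tabulate⁻ _ uv

  edge⁺ : ∀ i s t → classAdj colour i s t ≡ true → join m n s — join m n t ∈ₑ part i
  edge⁺ i s t st = ∈-tabulate⁺ _
    (trans (cong₂ (classAdj colour i) (splitAt-join m n s) (splitAt-join m n t)) st)

  class-0orD : ∀ i s → ZeroOr (deg i) (classDegree colour i s)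
  class-0orD i (inj₁ x) = row i x
  class-0orD i (inj₂ y) = column i y

  partition : RegularPartition (completeBipartite m n) k
  partition = record
    { part     = part
    ; nonempty = λ i → let (x , y , xy) = onto i in
                 join m n (inj₁ x) , join m n (inj₂ y) ,
                 edge⁺ i (inj₁ x) (inj₂ y) (dec-true (colour x y Finₚ.≟ i) xy)
    ; included = λ i {u} {v} uv →
                 ∈-tabulate⁺ _ (classAdj⇒xor colour i (splitAt m u) (splitAt m v) (edge⁻ i uv))
    ; covering = λ {u} {v} uv →
                 let (i , st) = xor⇒classAdj colour (splitAt m u) (splitAt m v) (∈-tabulate⁻ _ uv)
                 in i , ∈-tabulate⁺ _ st
    ; disjoint = λ {i} {j} {u} {v} p q →
                 classAdj-unique colour i j (splitAt m u) (splitAt m v) (edge⁻ i p) (edge⁻ j q)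
    ; regular  = λ i → regular⁺ (part i) (deg i) λ v →
                 subst (ZeroOr (deg i))
                   (sym (size-class colour i (splitAt m v) (EdgeSet.nbr (part i) v) λ t →
                     trans (lookup∘tabulate _ (join m n t))
                           (cong (classAdj colour i (splitAt m v)) (splitAt-join m n t))))
                   (class-0orD i (splitAt m v))
    }

module ToColouring {m n k} (P : RegularPartition (completeBipartite m n) k) where
  open RegularPartition P

  K-edge⁺ : ∀ s t → xor-side s t ≡ true → join m n s — join m n t ∈ₑ edges (completeBipartite m n)
  K-edge⁺ s t st = ∈-tabulate⁺ _ (trans (cong₂ xor-side (splitAt-join m n s) (splitAt-join m n t)) st)

  K-edge⁻ : ∀ s t → join m n s — join m n t ∈ₑ edges (completeBipartite m n) → xor-side s t ≡ true
  K-edge⁻ s t e = trans (cong₂ xor-side (sym (splitAt-join m n s)) (sym (splitAt-join m n t)))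
                        (∈-tabulate⁻ _ e)

  colour : Fin m → Fin n → Fin k
  colour x y = proj₁ (covering (K-edge⁺ (inj₁ x) (inj₂ y) refl))

  in-class : ∀ x y → x ↑ˡ n — m ↑ʳ y ∈ₑ part (colour x y)
  in-class x y = proj₂ (covering (K-edge⁺ (inj₁ x) (inj₂ y) refl))

  -- Across the sides, `disjoint` makes the index chosen by `covering` the only possible one; within
  -- a side, `included` rules out edges.
  lookup-nbr : ∀ i s t → lookup (EdgeSet.nbr (part i) (join m n s)) (join m n t) ≡ classAdj colour i s t
  lookup-nbr i (inj₁ x) (inj₂ y) = lookup≡does (colour x y Finₚ.≟ i)
    (λ { refl → in-class x y }) (disjoint (in-class x y))
  lookup-nbr i (inj₂ y) (inj₁ x) = lookup≡does (colour x y Finₚ.≟ i)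
    (λ { refl → EdgeSet.symm (part i) (in-class x y) })
    (λ e → disjoint (in-class x y) (EdgeSet.symm (part i) e))
  lookup-nbr i (inj₁ x) (inj₁ x′) = lookup≡does (no λ ()) ⊥-elim
    λ e → contradiction (K-edge⁻ (inj₁ x) (inj₁ x′) (included i e)) λ ()
  lookup-nbr i (inj₂ y) (inj₂ y′) = lookup≡does (no λ ()) ⊥-elim
    λ e → contradiction (K-edge⁻ (inj₂ y) (inj₂ y′) (included i e)) λ ()

  class-0orD : ∀ i s → ZeroOr (proj₁ (regular i)) (classDegree colour i s)
  class-0orD i s = subst (ZeroOr _) (size-class colour i s (EdgeSet.nbr (part i) (join m n s)) (lookup-nbr i s))
                         (regular⁻ (part i) (regular i) (join m n s))

  onto : ∀ i s t → join m n s — join m n t ∈ₑ part i → ∃₂ λ x y → colour x y ≡ i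
  onto i (inj₁ x) (inj₂ y) e = x , y , disjoint (in-class x y) e
  onto i (inj₂ y) (inj₁ x) e = x , y , disjoint (in-class x y) (EdgeSet.symm (part i) e)
  onto i (inj₁ x) (inj₁ x′) e = contradiction (K-edge⁻ (inj₁ x) (inj₁ x′) (included i e)) λ ()
  onto i (inj₂ y) (inj₂ y′) e = contradiction (K-edge⁻ (inj₂ y) (inj₂ y′) (included i e)) λ ()

  colouring : RegularColouring m n k
  colouring = record
    { colour = colour
    ; deg    = λ i → proj₁ (regular i)
    ; row    = λ i x → class-0orD i (inj₁ x)
    ; column = λ i y → class-0orD i (inj₂ y)
    ; onto   = λ i → let (u , v , uv) = nonempty i in
               onto i (splitAt m u) (splitAt m v)
                 (subst (λ u → u — join m n (splitAt m v) ∈ₑ part i) (sym (join-splitAt m n u))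
                   (subst (λ v → u — v ∈ₑ part i) (sym (join-splitAt m n v)) uv))
    }

-- The upper bound

-- Adds three columns, which together form a K_{3,3} given the new colour 0.
extend : ∀ {n k} → RegularColouring 3 n k → RegularColouring 3 (3 + n) (suc k)
extend {n} {k} K = record { colour = colour′ ; deg = deg′ ; row = row′ ; column = column′ ; onto = onto′ }
  where
  open RegularColouring K

  colour′ : Fin 3 → Fin (3 + n) → Fin (suc k)
  colour′ x 0F                  = zero
  colour′ x 1F                  = zero
  colour′ x 2F                  = zero
  colour′ x (suc (suc (suc y))) = suc (colour x y)

  deg′ : Fin (suc k) → ℕ
  deg′ zero    = 3
  deg′ (suc i) = deg i

  row′ : ∀ i x → ZeroOr (deg′ i) (tally (colour′ x) i)
  row′ zero    x = inj₂ (cong (3 +_) (sum-zero {n} _ λ _ → refl))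
  row′ (suc i) x = row i x

  column′ : ∀ i y → ZeroOr (deg′ i) (tally (λ x → colour′ x y) i)
  column′ zero    0F                  = inj₂ refl
  column′ zero    1F                  = inj₂ refl
  column′ zero    2F                  = inj₂ refl
  column′ zero    (suc (suc (suc y))) = inj₁ refl
  column′ (suc i) 0F                  = inj₁ refl
  column′ (suc i) 1F                  = inj₁ refl
  column′ (suc i) 2F                  = inj₁ refl
  column′ (suc i) (suc (suc (suc y))) = column i y

  onto′ : ∀ i → ∃₂ λ x y → colour′ x y ≡ i
  onto′ zero    = 0F , 0F , refl
  onto′ (suc i) = let (x , y , xy) = onto i in x , suc (suc (suc y)) , cong suc xy

extend^ : ∀ {r s} → RegularColouring 3 r s → ∀ q → RegularColouring 3 (q * 3 + r) (q + s)
extend^ K zero    = K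
extend^ K (suc q) = extend (extend^ K q)

empty : RegularColouring 3 0 0
empty = record { colour = λ _ () ; deg = λ () ; row = λ () ; column = λ () ; onto = λ () }

-- A cyclic Latin rectangle: for `n` at most 3 no colour repeats in a line, so every colour class is
-- a matching.
cyclic : ∀ n → Fin 3 → Fin n → Fin 3
cyclic n x y = (toℕ x + toℕ y) mod 3

-- For a concrete `n` the two conditions are decided by evaluation. All three colours already occur
-- in the first column.
matchings : ∀ n →
            True (all? λ i → all? λ x → zeroOr? 1 (tally (cyclic (suc n) x) i)) →
            True (all? λ i → all? λ y → zeroOr? 1 (tally (λ x → cyclic (suc n) x y) i)) →
            RegularColouring 3 (suc n) 3
matchings n rows columns = record
  { colour = cyclic (suc n)
  ; deg    = λ _ → 1
  ; row    = toWitness rows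
  ; column = toWitness columns
  ; onto   = λ { 0F → 0F , 0F , refl ; 1F → 1F , 0F , refl ; 2F → 2F , 0F , refl }
  }

-- The lower bound

module Line {n k} (deg : Fin k → ℕ) (f : Fin n → Fin k)
            (zeroOrDeg : ∀ i → ZeroOr (deg i) (tally f i)) where

  -- For a part of positive degree, the indicator that the line meets it.
  hit : Fin k → ℕ
  hit i = [ const 0 , const 1 ]′ (zeroOrDeg i)

  hit≤1 : ∀ i → hit i ≤ 1
  hit≤1 i with zeroOrDeg i
  ... | inj₁ _ = z≤n
  ... | inj₂ _ = ≤-refl

  tally≡hit*deg : ∀ i → tally f i ≡ hit i * deg i
  tally≡hit*deg i with zeroOrDeg i
  ... | inj₁ eq = eq
  ... | inj₂ eq = trans eq (sym (*-identityˡ _))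

module Weights {k} (deg : Fin k → ℕ) where

  w : ℕ → Fin k → ℕ
  w e i = ⟦ does (deg i ≟ e) ⟧

  -- The number of parts of degree `e`: the N₁, N₂, N₃ of the lower bound.
  N : ℕ → ℕ
  N e = ∑[ i < k ] w e i

  w-deg : ∀ e i → w e i * deg i ≡ e * w e i
  w-deg e i = iverson (deg i ≟ e)
    where
    iverson : ∀ {d} (d≟e : Dec (d ≡ e)) → ⟦ does d≟e ⟧ * d ≡ e * ⟦ does d≟e ⟧
    iverson (yes refl) = *-comm 1 e
    iverson (no  _)    = sym (*-zeroʳ e)

  w-sum : ∀ i → 1 ≤ deg i → deg i ≤ 3 → w 1 i + w 2 i + w 3 i ≡ 1
  w-sum i 1≤d d≤3 with deg i
  ... | 1 = refl
  ... | 2 = refl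
  ... | 3 = refl
  w-sum i _ (s≤s (s≤s (s≤s ()))) | suc (suc (suc (suc _)))

  module _ {n} (f : Fin n → Fin k) (zeroOrDeg : ∀ i → ZeroOr (deg i) (tally f i)) where
    open Line deg f zeroOrDeg

    cells : ℕ → ℕ
    cells e = ∑[ y < n ] w e (f y)

    hits : ℕ → ℕ
    hits e = ∑[ i < k ] (w e i * hit i)

    hits≤N : ∀ e → hits e ≤ N e
    hits≤N e = sum-mono λ i → ≤-trans (*-monoʳ-≤ (w e i) (hit≤1 i)) (≤-reflexive (*-identityʳ _))

    -- Every part of degree `e` that meets the line occupies exactly `e` of its cells.
    cells≡ : ∀ e → cells e ≡ e * hits e
    cells≡ e = begin
      cells e                              ≡⟨ sum-tally (w e) f ⟩
      ∑[ i < k ] (w e i * tally f i)       ≡⟨ sum-cong-≗ pointwise ⟩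
      ∑[ i < k ] (e * (w e i * hit i))     ≡⟨ *-distribˡ-sum e (λ i → w e i * hit i) ⟨
      e * hits e                           ∎
      where
      open ≡-Reasoning
      pointwise : ∀ i → w e i * tally f i ≡ e * (w e i * hit i)
      pointwise i = begin
        w e i * tally f i        ≡⟨ cong (w e i *_) (tally≡hit*deg i) ⟩
        w e i * (hit i * deg i)  ≡⟨ swap (w e i) (hit i) (deg i) ⟩
        w e i * deg i * hit i    ≡⟨ cong (_* hit i) (w-deg e i) ⟩
        e * w e i * hit i        ≡⟨ *-assoc e (w e i) (hit i) ⟩
        e * (w e i * hit i)      ∎
        where
        swap : ∀ a b c → a * (b * c) ≡ a * c * b
        swap = solve-∀

    cells-sum : (∀ i → 1 ≤ deg i) → (∀ i → deg i ≤ 3) → cells 1 + cells 2 + cells 3 ≡ n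
    cells-sum 1≤d d≤3 = begin
      cells 1 + cells 2 + cells 3                        ≡⟨ cong (_+ cells 3) (∑-distrib-+ (w 1 ∘ f) (w 2 ∘ f)) ⟨
      ∑[ y < n ] (w 1 (f y) + w 2 (f y)) + cells 3       ≡⟨ ∑-distrib-+ (λ y → w 1 (f y) + w 2 (f y)) (w 3 ∘ f) ⟨
      ∑[ y < n ] (w 1 (f y) + w 2 (f y) + w 3 (f y))     ≡⟨ sum-one {n} _ (λ y → w-sum (f y) (1≤d (f y)) (d≤3 (f y))) ⟩
      n                                                  ∎
      where open ≡-Reasoning

  N-sum : (∀ i → 1 ≤ deg i) → (∀ i → deg i ≤ 3) → N 1 + N 2 + N 3 ≡ k
  N-sum 1≤d d≤3 = begin
    N 1 + N 2 + N 3                          ≡⟨ cong (_+ N 3) (∑-distrib-+ (w 1) (w 2)) ⟨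
    ∑[ i < k ] (w 1 i + w 2 i) + N 3         ≡⟨ ∑-distrib-+ (λ i → w 1 i + w 2 i) (w 3) ⟨
    ∑[ i < k ] (w 1 i + w 2 i + w 3 i)       ≡⟨ sum-one {k} _ (λ i → w-sum i (1≤d i) (d≤3 i)) ⟩
    k                                        ∎
    where open ≡-Reasoning

-- p, q and r are the numbers of parts of degree 1, 2 and 3 that meet a column.
column-pattern : ∀ p q r → 1 * p + 2 * q + 3 * r ≡ 3 → 1 * p ≡ 3 ⊎ 2 * q ≡ 2 * (1 * p)
column-pattern p zero          zero    eq = inj₁ (trans (lemma p) eq)
  where
  lemma : ∀ p → 1 * p ≡ 1 * p + 0 + 0
  lemma = solve-∀
column-pattern p 1             zero    eq = inj₂ (cong (2 *_) (sym (+-cancelʳ-≡ 2 (1 * p) 1 (trans (lemma p) eq))))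
  where
  lemma : ∀ p → 1 * p + 2 ≡ 1 * p + 2 + 0
  lemma = solve-∀
column-pattern p (suc (suc q)) zero    eq = contradiction eq (>⇒≢ (≤-trans (m≤m+n 4 (p + 2 * q)) (≤-reflexive (lemma p q))))
  where
  lemma : ∀ p q → 4 + (p + 2 * q) ≡ 1 * p + 2 * (2 + q) + 0
  lemma = solve-∀
-- A column inside a part of degree 3 is balanced trivially: both sides are 0.
column-pattern zero    zero    (suc r) eq = inj₂ refl
column-pattern (suc p) q       (suc r) eq = contradiction eq (>⇒≢ (≤-trans (m≤m+n 4 (p + 2 * q + 3 * r)) (≤-reflexive (lemma p q r))))
  where
  lemma : ∀ p q r → 4 + (p + 2 * q + 3 * r) ≡ 1 * (1 + p) + 2 * q + 3 * (1 + r)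
  lemma = solve-∀
column-pattern zero    (suc q) (suc r) eq = contradiction eq (>⇒≢ (≤-trans (m≤m+n 4 (1 + 2 * q + 3 * r)) (≤-reflexive (lemma q r))))
  where
  lemma : ∀ q r → 4 + (1 + 2 * q + 3 * r) ≡ 2 * (1 + q) + 3 * (1 + r)
  lemma = solve-∀

<-of-nonmultiple : ∀ {m} j → m % 3 ≢ 0 → m ≤ 3 * j → m < 3 * j
<-of-nonmultiple j 3∤m m≤3j =
  ≤∧≢⇒< m≤3j λ m≡3j → 3∤m (trans (cong (_% 3) (trans m≡3j (*-comm 3 j))) (m*n%n≡0 j 3))

-- Here a and b count the parts of degree 1 and 2, and m is the number of columns that lie outside the
-- parts of degree 3; row x has f x cells in parts of degree 1 and meets g x parts of degree 2.
module _ (f g : Fin 3 → ℕ) {a b m : ℕ}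
         (f+2g : ∀ x → f x + 2 * g x ≡ m) (f≤a : ∀ x → f x ≤ a) (g≤b : ∀ x → g x ≤ b) where

  module Balanced (bal : ∑[ x < 3 ] (2 * g x) ≡ 2 * sum f) where

    sum-g≡sum-f : sum g ≡ sum f
    sum-g≡sum-f = *-cancelˡ-≡ (sum g) (sum f) 2 (trans (*-distribˡ-sum 2 g) bal)

    -- The three rows have 3 m remaining cells, of which `sum f` are of degree 1 and, by balance,
    -- twice as many of degree 2.
    sum-f≡m : sum f ≡ m
    sum-f≡m = *-cancelˡ-≡ (sum f) m 3 (begin
      3 * sum f                              ≡⟨⟩
      sum f + 2 * sum f                      ≡⟨ cong (sum f +_) bal ⟨
      sum f + ∑[ x < 3 ] (2 * g x)           ≡⟨ ∑-distrib-+ f (λ x → 2 * g x) ⟨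
      ∑[ x < 3 ] (f x + 2 * g x)             ≡⟨ sum-cong-≗ f+2g ⟩
      3 * m                                  ∎)
      where open ≡-Reasoning

    sum-g≡m : sum g ≡ m
    sum-g≡m = trans sum-g≡sum-f sum-f≡m

    m≤3a : m ≤ 3 * a
    m≤3a = ≤-trans (≤-reflexive (sym sum-f≡m)) (sum-mono f≤a)

    m≤3b : m ≤ 3 * b
    m≤3b = ≤-trans (≤-reflexive (sym sum-g≡m)) (sum-mono g≤b)

    -- Here m ≤ 3 and 3 does not divide m, so m is 1 or 2. If m = 1, no row has room for two cells
    -- of a part of degree 2, so g vanishes, against `sum g` = m. If m = 2, each `f x` is even and
    -- at most 1, so f vanishes, against `sum f` = m.
    ¬singles : a ≤ 1 → b ≤ 1 → m % 3 ≢ 0 → ⊥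
    ¬singles a≤1 b≤1 3∤m = small m refl (≤-trans m≤3a (*-monoʳ-≤ 3 a≤1))
      where
      g≡0 : m ≡ 1 → ∀ x → g x ≡ 0
      g≡0 refl x with g x | f+2g x
      ... | zero  | _  = refl
      ... | suc c | eq = contradiction eq (>⇒≢ (≤-trans (m≤m+n 2 (f x + 2 * c)) (≤-reflexive (lemma (f x) c))))
        where
        lemma : ∀ p q → 2 + (p + 2 * q) ≡ p + 2 * (1 + q)
        lemma = solve-∀

      f≡0 : m ≡ 2 → ∀ x → f x ≡ 0
      f≡0 refl x with f x | g x | f+2g x | ≤-trans (f≤a x) a≤1
      ... | zero  | _     | _  | _      = refl
      ... | 1     | zero  | () | _
      ... | 1     | suc c | eq | _      = contradiction eq (>⇒≢ (≤-trans (m≤m+n 3 (2 * c)) (≤-reflexive (lemma c))))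
        where
        lemma : ∀ q → 3 + 2 * q ≡ 1 + 2 * (1 + q)
        lemma = solve-∀
      ... | suc (suc _) | _ | _ | s≤s ()

      small : ∀ l → m ≡ l → m ≤ 3 → ⊥
      small 0 m≡0 _ = 3∤m (cong (_% 3) m≡0)
      small 1 m≡1 _ = contradiction (trans (trans (sym m≡1) (sym sum-g≡m)) (sum-zero g (g≡0 m≡1))) λ ()
      small 2 m≡2 _ = contradiction (trans (trans (sym m≡2) (sym sum-f≡m)) (sum-zero f (f≡0 m≡2))) λ ()
      small 3 m≡3 _ = 3∤m (cong (_% 3) m≡3)
      small (suc (suc (suc (suc l)))) refl (s≤s (s≤s (s≤s ())))

  rows-bound : m % 3 ≢ 0 → 3 ≤ a ⊎ ∑[ x < 3 ] (2 * g x) ≡ 2 * sum f → 6 + m < 3 * (a + b)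
  -- `(6 + m) % 3` computes to `m % 3`, so `3∤m` also applies to `6 + m`.
  rows-bound 3∤m hyp = <-of-nonmultiple (a + b) 3∤m (weak hyp)
    where
    open ≤-Reasoning
    weak : 3 ≤ a ⊎ ∑[ x < 3 ] (2 * g x) ≡ 2 * sum f → 6 + m ≤ 3 * (a + b)
    weak (inj₁ 3≤a) = begin
      -- Any row would do: it gives m ≤ a + 2 b, while 3 ≤ a gives 6 ≤ 2 a.
      6 + m                    ≡⟨ cong (6 +_) (f+2g 0F) ⟨
      6 + (f 0F + 2 * g 0F)    ≤⟨ +-mono-≤ (*-monoʳ-≤ 2 3≤a) (+-mono-≤ (f≤a 0F) (*-monoʳ-≤ 2 (g≤b 0F))) ⟩
      2 * a + (a + 2 * b)      ≤⟨ m≤m+n _ b ⟩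
      2 * a + (a + 2 * b) + b  ≡⟨ lemma a b ⟩
      3 * (a + b)              ∎
      where
      lemma : ∀ a b → 2 * a + (a + 2 * b) + b ≡ 3 * (a + b)
      lemma = solve-∀
    weak (inj₂ bal) with 2 ≤? a | 2 ≤? b
    -- One of 3 a and 3 b absorbs the 6 and the other absorbs m.
    ... | yes 2≤a | _       = ≤-trans (+-mono-≤ (*-monoʳ-≤ 3 2≤a) (Balanced.m≤3b bal)) (≤-reflexive (sym (*-distribˡ-+ 3 a b)))
    ... | no  _   | yes 2≤b = ≤-trans (+-mono-≤ (*-monoʳ-≤ 3 2≤b) (Balanced.m≤3a bal))
                                (≤-reflexive (trans (+-comm (3 * b) (3 * a)) (sym (*-distribˡ-+ 3 a b))))
    ... | no  2≰a | no 2≰b  = ⊥-elim (Balanced.¬singles bal (s≤s⁻¹ (≰⇒> 2≰a)) (s≤s⁻¹ (≰⇒> 2≰b)) 3∤m)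

module LowerBound {n k} (K : RegularColouring 3 n k) where
  open RegularColouring K
  open Weights deg

  rowCells rowHits : ℕ → Fin 3 → ℕ
  rowCells e x = cells (colour x) (λ i → row i x) e
  rowHits  e x = hits  (colour x) (λ i → row i x) e

  columnCells columnHits : ℕ → Fin n → ℕ
  columnCells e y = cells (λ x → colour x y) (λ i → column i y) e
  columnHits  e y = hits  (λ x → colour x y) (λ i → column i y) e

  -- The cell in row `x` itself has this colour, so the tally is not 0.
  column-deg : ∀ x y → tally (λ x → colour x y) (colour x y) ≡ deg (colour x y)
  column-deg x y with column (colour x y) y
  ... | inj₁ ≡0 = contradiction ≡0 (m<n⇒n≢0 (tally-pos (λ x → colour x y) x))
  ... | inj₂ eq = eq

  1≤deg : ∀ i → 1 ≤ deg i
  1≤deg i with onto i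
  ... | x , y , refl = ≤-trans (tally-pos (λ x → colour x y) x) (≤-reflexive (column-deg x y))

  deg≤3 : ∀ i → deg i ≤ 3
  deg≤3 i with onto i
  ... | x , y , refl = ≤-trans (≤-reflexive (sym (column-deg x y))) (tally≤ (λ x → colour x y) _)

  -- A part of degree 3 contains all three cells of each column it meets, so it meets every row.
  full : ∀ i x → deg i ≡ 3 → Line.hit deg (colour x) (λ i → row i x) i ≡ 1
  full i x d≡3 with onto i
  ... | x₀ , y , refl with row (colour x₀ y) x
  ...   | inj₂ _  = refl
  ...   | inj₁ ≡0 = contradiction ≡0 (m<n⇒n≢0 (subst (λ j → 1 ≤ tally (colour x) j) xy≡i (tally-pos (colour x) y)))
    where
    xy≡i : colour x y ≡ colour x₀ y
    xy≡i = does-true⁻ (colour x y Finₚ.≟ colour x₀ y)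
             (sum-⟦⟧-full (λ x → does (colour x y Finₚ.≟ colour x₀ y)) (trans (column-deg x₀ y) d≡3) x)

  -- Parts of degree 3 meet every row, so they take the same number of cells, 3 N₃, from each.
  rowHits₃ : ∀ x → rowHits 3 x ≡ N 3
  rowHits₃ x = sum-cong-≗ pointwise
    where
    iverson : ∀ {A : Set} {h} (a? : Dec A) → (A → h ≡ 1) → ⟦ does a? ⟧ * h ≡ ⟦ does a? ⟧
    iverson (yes a) h≡1 = trans (+-identityʳ _) (h≡1 a)
    iverson (no _)  _   = refl

    pointwise : ∀ i → w 3 i * Line.hit deg (colour x) (λ i → row i x) i ≡ w 3 i
    pointwise i = iverson (deg i ≟ 3) (full i x)

  row-sum : ∀ x → 1 * rowHits 1 x + 2 * rowHits 2 x + 3 * rowHits 3 x ≡ n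
  row-sum x = trans (sym (cong₂ _+_ (cong₂ _+_ (eq 1) (eq 2)) (eq 3)))
                    (cells-sum (colour x) (λ i → row i x) 1≤deg deg≤3)
    where eq = cells≡ (colour x) (λ i → row i x)

  column-sum : ∀ y → 1 * columnHits 1 y + 2 * columnHits 2 y + 3 * columnHits 3 y ≡ 3
  column-sum y = trans (sym (cong₂ _+_ (cong₂ _+_ (eq 1) (eq 2)) (eq 3)))
                       (cells-sum (λ x → colour x y) (λ i → column i y) 1≤deg deg≤3)
    where eq = cells≡ (λ x → colour x y) (λ i → column i y)

  -- The m of the lower bound, read off row `0F`; `outside≡` shows that every row gives the same
  -- value.
  outside : ℕ
  outside = rowCells 1 0F + 2 * rowHits 2 0F

  n≡ : ∀ x → n ≡ rowCells 1 x + 2 * rowHits 2 x + 3 * N 3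
  n≡ x = sym (trans (cong₂ _+_ (cong (_+ 2 * rowHits 2 x) (cells≡ (colour x) (λ i → row i x) 1))
                               (cong (3 *_) (sym (rowHits₃ x)))) (row-sum x))

  outside≡ : ∀ x → rowCells 1 x + 2 * rowHits 2 x ≡ outside
  outside≡ x = +-cancelʳ-≡ (3 * N 3) _ _ (trans (sym (n≡ x)) (n≡ 0F))

  -- With fewer than three parts of degree 1, no column consists of three cells of degree 1. Every
  -- column then has twice as many cells of degree 2 as of degree 1; exchanging the order of
  -- summation carries this over to the rows.
  balanced : ¬ 3 ≤ N 1 → ∑[ x < 3 ] (2 * rowHits 2 x) ≡ 2 * sum (rowCells 1)
  balanced 3≰N₁ = begin
    ∑[ x < 3 ] (2 * rowHits 2 x)         ≡⟨ sum-cong-≗ (λ x → sym (cells≡ (colour x) (λ i → row i x) 2)) ⟩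
    ∑[ x < 3 ] rowCells 2 x              ≡⟨ ∑-comm (λ x y → w 2 (colour x y)) ⟩
    ∑[ y < n ] columnCells 2 y           ≡⟨ sum-cong-≗ column-balanced ⟩
    ∑[ y < n ] (2 * columnCells 1 y)     ≡⟨ *-distribˡ-sum 2 (columnCells 1) ⟨
    2 * sum (columnCells 1)              ≡⟨ cong (2 *_) (∑-comm (λ x y → w 1 (colour x y))) ⟨
    2 * sum (rowCells 1)                 ∎
    where
    open ≡-Reasoning
    column-balanced : ∀ y → columnCells 2 y ≡ 2 * columnCells 1 y
    column-balanced y with column-pattern (columnHits 1 y) (columnHits 2 y) (columnHits 3 y) (column-sum y)
    ... | inj₁ ≡3 = contradiction
      (≤-trans (≤-reflexive (sym (trans (sym (*-identityˡ _)) ≡3))) (hits≤N (λ x → colour x y) (λ i → column i y) 1)) 3≰N₁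
    ... | inj₂ eq = trans (cells≡ (λ x → colour x y) (λ i → column i y) 2)
                     (trans eq (cong (2 *_) (sym (cells≡ (λ x → colour x y) (λ i → column i y) 1))))

  N₁≥3-or-balanced : 3 ≤ N 1 ⊎ ∑[ x < 3 ] (2 * rowHits 2 x) ≡ 2 * sum (rowCells 1)
  N₁≥3-or-balanced with 3 ≤? N 1
  ... | yes 3≤N₁ = inj₁ 3≤N₁
  ... | no  3≰N₁ = inj₂ (balanced 3≰N₁)

  rowCells₁≤N₁ : ∀ x → rowCells 1 x ≤ N 1
  rowCells₁≤N₁ x = ≤-trans (≤-reflexive (trans (cells≡ (colour x) (λ i → row i x) 1) (*-identityˡ _)))
                           (hits≤N (colour x) (λ i → row i x) 1)

  -- A part covers at most three of the n cells of a row.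
  n≤3k : n ≤ 3 * k
  n≤3k = begin
    n                                                     ≡⟨ n≡ 0F ⟩
    rowCells 1 0F + 2 * rowHits 2 0F + 3 * N 3            ≤⟨ +-monoˡ-≤ (3 * N 3) (+-mono-≤ (rowCells₁≤N₁ 0F) (*-monoʳ-≤ 2 (hits≤N (colour 0F) (λ i → row i 0F) 2))) ⟩
    N 1 + 2 * N 2 + 3 * N 3                               ≤⟨ m≤m+n _ (2 * N 1 + N 2) ⟩
    N 1 + 2 * N 2 + 3 * N 3 + (2 * N 1 + N 2)             ≡⟨ lemma (N 1) (N 2) (N 3) ⟩
    3 * (N 1 + N 2 + N 3)                                 ≡⟨ cong (3 *_) (N-sum 1≤deg deg≤3) ⟩
    3 * k                                                 ∎
    where
    open ≤-Reasoning
    lemma : ∀ a b c → a + 2 * b + 3 * c + (2 * a + b) ≡ 3 * (a + b + c)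
    lemma = solve-∀

  6+n<3k : n % 3 ≢ 0 → 6 + n < 3 * k
  6+n<3k 3∤n = begin-strict
    6 + n                              ≡⟨ cong (6 +_) (n≡ 0F) ⟩
    6 + (outside + 3 * N 3)            ≡⟨ +-assoc 6 outside (3 * N 3) ⟨
    6 + outside + 3 * N 3              <⟨ +-monoˡ-< (3 * N 3) (rows-bound (rowCells 1) (rowHits 2) outside≡ rowCells₁≤N₁
                                            (λ x → hits≤N (colour x) (λ i → row i x) 2) 3∤outside N₁≥3-or-balanced) ⟩
    3 * (N 1 + N 2) + 3 * N 3          ≡⟨ *-distribˡ-+ 3 (N 1 + N 2) (N 3) ⟨
    3 * (N 1 + N 2 + N 3)              ≡⟨ cong (3 *_) (N-sum 1≤deg deg≤3) ⟩
    3 * k                              ∎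
    where
    open ≤-Reasoning
    -- `n` and `outside` differ by the multiple `3 * N 3` of 3.
    3∤outside : outside % 3 ≢ 0
    3∤outside eq = 3∤n (trans (cong (_% 3) (trans (n≡ 0F) (cong (outside +_) (*-comm 3 (N 3)))))
                              (trans ([m+kn]%n≡m%n outside (N 3) 3) eq))

-- The regular number of K_{3,n}

n≡[n/3]*3+ : ∀ n {r} → n % 3 ≡ r → n / 3 * 3 + r ≡ n
n≡[n/3]*3+ n refl = trans (+-comm (n / 3 * 3) (n % 3)) (sym (m≡m%n+[m/n]*n n 3))

partition-from : ∀ {r s} → RegularColouring 3 r s → ∀ n → n % 3 ≡ r →
                 RegularPartition (completeBipartite 3 n) (n / 3 + s)
partition-from {s = s} K n n%3≡r =
  subst (λ n′ → RegularPartition (completeBipartite 3 n′) (n / 3 + s)) (n≡[n/3]*3+ n n%3≡r)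
    (FromColouring.partition (extend^ K (n / 3)))

isRegularNumber-0 : ∀ n → n % 3 ≡ 0 → IsRegularNumber (completeBipartite 3 n) (n / 3)
isRegularNumber-0 n n%3≡0 =
  subst (RegularPartition _) (+-identityʳ (n / 3)) (partition-from empty n n%3≡0) ,
  λ k P → *-cancelˡ-≤ 3 (≤-trans (≤-reflexive (trans (*-comm 3 (n / 3)) (trans (sym (+-identityʳ _)) (n≡[n/3]*3+ n n%3≡0))))
                                 (LowerBound.n≤3k (ToColouring.colouring P)))

isRegularNumber-≢0 : ∀ {r} → RegularColouring 3 (suc r) 3 → ∀ n → n % 3 ≡ suc r →
                     IsRegularNumber (completeBipartite 3 n) (n / 3 + 3)
isRegularNumber-≢0 {r} K n n%3≡ = partition-from K n n%3≡ , λ k P →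
  -- On naturals `2 + n / 3 < k` is `3 + n / 3 ≤ k`, so the strict bound 6 + n < 3 k yields the full
  -- 3 beyond the quotient.
  subst (_≤ k) (+-comm 3 (n / 3)) (*-cancelˡ-< 3 (2 + n / 3) k (begin-strict
    3 * (2 + n / 3)            ≤⟨ m≤m+n _ (suc r) ⟩
    3 * (2 + n / 3) + suc r    ≡⟨ lemma (n / 3) (suc r) ⟩
    6 + (n / 3 * 3 + suc r)    ≡⟨ cong (6 +_) (n≡[n/3]*3+ n n%3≡) ⟩
    6 + n                      <⟨ LowerBound.6+n<3k (ToColouring.colouring P) (λ n%3≡0 → 1+n≢0 (trans (sym n%3≡) n%3≡0)) ⟩
    3 * k                      ∎))
  where
  open ≤-Reasoning
  lemma : ∀ q r → 3 * (2 + q) + r ≡ 6 + (q * 3 + r)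
  lemma = solve-∀

theorem5 : ∀ (n : ℕ) → 1 ≤ n →
    (n % 3 ≡ 0 → IsRegularNumber (completeBipartite 3 n) (n / 3)) ×
    (n % 3 ≡ 1 ⊎ n % 3 ≡ 2 → IsRegularNumber (completeBipartite 3 n) (n / 3 + 3))
theorem5 n _ = isRegularNumber-0 n ,
  -- The leftover graphs are K_{3,1} and K_{3,2}; each `tt` is accepted because the decision
  -- procedure for that size evaluates to yes.
  [ isRegularNumber-≢0 (matchings 0 tt tt) n
  , isRegularNumber-≢0 (matchings 1 tt tt) n ]′
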